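{- Let $a>1$ be an integer, let $p$ be a prime, let $K \ge 1$ be an integer, and let $N = 2Kp+1$. Suppose that $2K \le p$ and $2K < \log_a(2Kp+1)$. Then $N$ is prime if and only if $a^{N-1} \equiv 1 \pmod N$. -}

module Defs where

open import Data.Nat using (ℕ; suc; _*_; _^_; _<_)
open import Data.Integer using (+_; -[1+_]; _-_)
open import Data.Integer.Divisibility using (_∣_)
open import Data.Rational.Unnormalised using (ℚᵘ; mkℚᵘ)

infix 4 _<log[_]_ _≡_[mod_]

-- The lower Dedekind cut of the real number log_a x, for a > 1 and x ≥ 1:
-- r/s < log_a x  iff  a^(r/s) < x  iff  a^r < x^s  (s > 0), where for
-- negative r = -m the power of a is moved to the other side.
-- The second argument of mkℚᵘ is the denominator minus one.
_<log[_]_ : ℚᵘ → ℕ → ℕ → Set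
mkℚᵘ (+ r)    s-1 <log[ a ] x = a ^ r < x ^ suc s-1
mkℚᵘ -[1+ m ] s-1 <log[ a ] x = 1 < a ^ suc m * x ^ suc s-1

_≡_[mod_] : ℕ → ℕ → ℕ → Set
b ≡ c [mod n ] = + n ∣ (+ b - + c)

{-# OPTIONS --safe #-}
-- Put b = a^(2K) and S = 1 + b + ... + b^(p-1).  If N ∣ b^p - 1 = (b - 1) S, then, since
-- 1 < b < N rules out N ∣ b - 1, some prime q divides both N and S.  Then b^p ≡ 1 (mod q), and
-- b ≢ 1 (mod q), for otherwise S ≡ p (mod q) would force q = p, which does not divide
-- N = 2Kp + 1.  So b has order p modulo q, and p ∣ q - 1 by Fermat.  Writing N = q r, also
-- r ≡ 1 (mod p), so r ≠ 1 would give N ≥ (p + 1)² > 2Kp + 1.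
module Submission where

open import Defs
open import Data.Nat using (ℕ; _+_; _*_; _∸_; _^_; _≤_; _<_; _>_; _≥_)
open import Data.Nat.Primality using (Prime)
open import Data.Integer using (+_)
open import Data.Rational.Unnormalised using (_/_)
open import Function.Bundles using (_⇔_)
open import Relation.Binary.PropositionalEquality using (_≡_)

open import Algebra.Properties.CommutativeSemiring.Binomial using (binomialTerm; theorem)
open import Algebra.Properties.Monoid.Sum using (sum-init-last)
import Algebra.Definitions.RawMonoid as RawMonoid
import Algebra.Definitions.RawSemiring as RawSemiring
open import Algebra.Bundles using (CommutativeSemiring)
open import Data.Empty using (⊥-elim)
open import Data.Fin using (Fin; zero; suc; toℕ; fromℕ; inject₁)
open import Data.Fin.Properties using (toℕ-inject₁; toℕ-fromℕ; toℕ<n)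
open import Data.List using ([]; _∷_)
open import Data.Nat.ListAction using (product)
open import Data.List.Relation.Unary.All using (_∷_)
open import Data.Nat using (zero; suc; pred; z≤n; s≤s; NonZero; nonTrivial⇒n>1; >-nonZero; ≢-nonZero; ≢-nonZero⁻¹; _!; _≟_)
open import Data.Nat.Combinatorics using (_C_; nCn≡1; nCk≡n!/k![n-k]!; k![n∸k]!∣n!)
open import Data.Nat.Coprimality using (Coprime; coprime-Bézout; coprime-divisor; gcd≡1⇒coprime)
import Data.Nat.Divisibility as ∣
open ∣ using (_∣_; divides; ∣-trans; ∣m+n∣m⇒∣n; ∣m∣n⇒∣m+n; m∣m*n; n∣m*n;
  ∣m⇒∣m*n; ∣⇒≤; ∣1⇒≡1; _∣?_)
open import Data.Nat.DivMod using (m/n*n≡m)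
open import Data.Nat.GCD using (gcd; gcd[m,n]∣m; gcd[m,n]∣n; gcd[m,n]≡0⇒m≡0; module Bézout)
open import Data.Nat.Primality using (prime⇒nonZero; prime⇒nonTrivial; prime⇒irreducible; ¬prime[0]; ¬prime[1]; euclidsLemma)
open import Data.Nat.Primality.Factorisation using (factorise)
open import Data.Nat.Properties
open import Data.Nat.Tactic.RingSolver using (solve-∀)
open import Data.Product using (∃; _×_; _,_)
open import Data.Sum using (inj₁; inj₂)
open import Data.Vec.Functional using (Vector; init)
open import Function using (_∘_; case_of_; Equivalence; mk⇔)
open import Relation.Binary.PropositionalEquality using (refl; sym; trans; cong; cong₂; subst; module ≡-Reasoning)
open import Relation.Nullary using (¬_; yes; no)

-- Binomial coefficients and `p`-th powers modulo a prime `p`.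

private
  module ℕ-semiring = CommutativeSemiring +-*-commutativeSemiring
  open RawMonoid ℕ-semiring.+-rawMonoid using (sum) renaming (_×_ to _·_)
  open RawSemiring ℕ-semiring.rawSemiring using () renaming (_^_ to _^ʳ_)

·≡* : ∀ m n → m · n ≡ m * n
·≡* zero    n = refl
·≡* (suc m) n = cong (_+_ n) (·≡* m n)

^ʳ≡^ : ∀ m n → m ^ʳ n ≡ m ^ n
^ʳ≡^ m zero    = refl
^ʳ≡^ m (suc n) = cong (m *_) (^ʳ≡^ m n)

∣-sum : ∀ {n d} (t : Vector ℕ n) → (∀ i → d ∣ t i) → d ∣ sum t
∣-sum {zero}  {d} t d∣t = d ∣.∣0
∣-sum {suc n}     t d∣t = ∣m∣n⇒∣m+n (d∣t zero) (∣-sum (t ∘ suc) (d∣t ∘ suc))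

prime∤1 : ∀ {p} → Prime p → ¬ p ∣ 1
prime∤1 pp p∣1 = ¬prime[1] (subst Prime (∣1⇒≡1 p∣1) pp)

prime∣!⇒≤ : ∀ {p} → Prime p → ∀ n → p ∣ n ! → p ≤ n
prime∣!⇒≤ pp zero    p∣1 = ⊥-elim (prime∤1 pp p∣1)
prime∣!⇒≤ pp (suc n) p∣n! with euclidsLemma (suc n) (n !) pp p∣n!
... | inj₁ p∣1+n = ∣⇒≤ p∣1+n
... | inj₂ p∣[n]! = ≤-trans (prime∣!⇒≤ pp n p∣[n]!) (n≤1+n n)

-- `p` divides `p ! = (p C k) * (k ! * (p ∸ k) !)`, but `k !` and `(p ∸ k) !` have only factors
-- below `p`, so Euclid's lemma leaves the coefficient.
prime∣C : ∀ {p k} → Prime p → 0 < k → k < p → p ∣ p C k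
prime∣C {p} {k} pp 0<k k<p with euclidsLemma (p C k) (k ! * (p ∸ k) !) pp p∣prod
  where
  instance _ = k !* (p ∸ k) !≢0
  p∣p! : ∀ {p} → Prime p → p ∣ p !
  p∣p! {zero}  pp = ⊥-elim (¬prime[0] pp)
  p∣p! {suc p} pp = m∣m*n (p !)
  k≤p = <⇒≤ k<p
  p∣prod : p ∣ (p C k) * (k ! * (p ∸ k) !)
  p∣prod = subst (p ∣_) (sym (trans (cong (_* (k ! * (p ∸ k) !)) (nCk≡n!/k![n-k]! k≤p))
                                    (m/n*n≡m (k![n∸k]!∣n! k≤p)))) (p∣p! pp)
... | inj₁ p∣C = p∣C
... | inj₂ p∣k![p-k]! with euclidsLemma (k !) ((p ∸ k) !) pp p∣k![p-k]!
...   | inj₁ p∣k!     = ⊥-elim (<⇒≱ k<p (prime∣!⇒≤ pp k p∣k!))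
...   | inj₂ p∣[p-k]! = ⊥-elim (<⇒≱ (∸-monoʳ-< 0<k (<⇒≤ k<p)) (prime∣!⇒≤ pp (p ∸ k) p∣[p-k]!))

freshman's-dream : ∀ {p} → Prime p → ∀ x y → ∃ λ m → (x + y) ^ p ≡ x ^ p + y ^ p + m * p
freshman's-dream {zero}  pp = ⊥-elim (¬prime[0] pp)
freshman's-dream {p@(suc n)} pp x y = ∣.quotient p∣middle , (begin
  (x + y) ^ p                               ≡⟨ ^ʳ≡^ (x + y) p ⟨
  (x + y) ^ʳ p                              ≡⟨ theorem +-*-commutativeSemiring p x y ⟩
  first + sum (t ∘ suc)                     ≡⟨ cong (_+_ first) (sum-init-last ℕ-semiring.+-monoid (t ∘ suc)) ⟩
  first + (sum middle + final)              ≡⟨ cong₂ _+_ first≡ (cong₂ _+_ (∣.m∣n⇒n≡quotient*m p∣middle) final≡) ⟩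
  y ^ p + (∣.quotient p∣middle * p + x ^ p) ≡⟨ rearrange (y ^ p) (∣.quotient p∣middle * p) (x ^ p) ⟩
  x ^ p + y ^ p + ∣.quotient p∣middle * p   ∎)
  where
  open ≡-Reasoning
  t : Vector ℕ (suc p)
  t = binomialTerm +-*-commutativeSemiring x y p
  -- The terms are ordered by rising powers of `x`: the first is `y ^ p`, the final one `x ^ p`.
  first = t zero
  middle = init (t ∘ suc)
  final = t (suc (fromℕ n))
  p∣middle : p ∣ sum middle
  -- Entry `i` of `middle` is the term of index `i + 1`, strictly between 0 and `p`.
  p∣middle = ∣-sum middle λ i →
    subst (p ∣_) (sym (·≡* (p C toℕ (suc (inject₁ i))) _))
      (∣m⇒∣m*n _ (prime∣C pp (s≤s z≤n) (s≤s (subst (_< n) (sym (toℕ-inject₁ i)) (toℕ<n i)))))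
  first≡ : first ≡ y ^ p
  first≡ = begin
    1 * y ^ʳ p + 0 ≡⟨ +-identityʳ _ ⟩
    1 * y ^ʳ p     ≡⟨ *-identityˡ _ ⟩
    y ^ʳ p         ≡⟨ ^ʳ≡^ y p ⟩
    y ^ p          ∎
  final≡ : final ≡ x ^ p
  final≡ rewrite toℕ-fromℕ n | nCn≡1 p | n∸n≡0 n = begin
    x ^ʳ p * 1 + 0 ≡⟨ +-identityʳ _ ⟩
    x ^ʳ p * 1     ≡⟨ *-identityʳ _ ⟩
    x ^ʳ p         ≡⟨ ^ʳ≡^ x p ⟩
    x ^ p          ∎
  rearrange : ∀ u v w → u + (v + w) ≡ w + u + v
  rearrange = solve-∀

-- Induction on `x`: by `freshman's-dream`, raising the base by 1 raises its `p`-th power by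
-- `1 ^ p = 1` modulo `p`.
x^p≡x+mp : ∀ {p} → Prime p → ∀ x → ∃ λ m → x ^ p ≡ x + m * p
x^p≡x+mp {zero}  pp zero = ⊥-elim (¬prime[0] pp)
x^p≡x+mp {suc p} pp zero = 0 , refl
x^p≡x+mp {p} pp (suc x) with x^p≡x+mp pp x | freshman's-dream pp 1 x
... | m , x^p≡ | k , [1+x]^p≡ = m + k , (begin
  suc x ^ p               ≡⟨ [1+x]^p≡ ⟩
  1 ^ p + x ^ p + k * p   ≡⟨ cong₂ (λ u v → u + v + k * p) (^-zeroˡ p) x^p≡ ⟩
  1 + (x + m * p) + k * p ≡⟨ rearrange x m k p ⟩
  suc x + (m + k) * p     ∎)
  where
  open ≡-Reasoning
  rearrange : ∀ x m k p → 1 + (x + m * p) + k * p ≡ suc x + (m + k) * p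
  rearrange = solve-∀

-- Geometric sums.

-- Horner form of `1 + b + ... + b ^ (n - 1)`.
geometric : ℕ → ℕ → ℕ
geometric b zero    = 0
geometric b (suc n) = 1 + b * geometric b n

^≡1+[b-1]*geometric : ∀ c n → suc c ^ n ≡ 1 + c * geometric (suc c) n
^≡1+[b-1]*geometric c zero    = cong suc (sym (*-zeroʳ c))
^≡1+[b-1]*geometric c (suc n) = trans (cong (suc c *_) (^≡1+[b-1]*geometric c n)) (rearrange c (geometric (suc c) n))
  where
  rearrange : ∀ c g → suc c * (1 + c * g) ≡ 1 + c * (1 + suc c * g)
  rearrange = solve-∀

-- Each of the `n` summands is a power of `suc c`, hence 1 modulo `c`.
geometric≡n+ch : ∀ c n → ∃ λ h → geometric (suc c) n ≡ n + c * h
geometric≡n+ch c zero    = 0 , sym (*-zeroʳ c)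
geometric≡n+ch c (suc n) with geometric≡n+ch c n
... | h , eq = h + geometric (suc c) n , (begin
  1 + (geometric (suc c) n + c * geometric (suc c) n) ≡⟨ cong (λ g → 1 + (g + c * geometric (suc c) n)) eq ⟩
  1 + (n + c * h + c * geometric (suc c) n)           ≡⟨ rearrange n c h (geometric (suc c) n) ⟩
  suc n + c * (h + geometric (suc c) n)               ∎)
  where
  open ≡-Reasoning
  rearrange : ∀ n c h g → 1 + (n + c * h + c * g) ≡ suc n + c * (h + g)
  rearrange = solve-∀

-- Congruences to 1 and Fermat's little theorem.

infix 4 _≡1[mod_]
-- The explicit quotient avoids subtraction and forces `x` to be positive, whatever `d` is.
_≡1[mod_] : ℕ → ℕ → Set
x ≡1[mod d ] = ∃ λ u → x ≡ 1 + u * d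

≡1⇒∣ : ∀ {c d} → suc c ≡1[mod d ] → d ∣ c
≡1⇒∣ (u , eq) = divides u (suc-injective eq)

∣⇒≡1 : ∀ {c d} → d ∣ c → suc c ≡1[mod d ]
∣⇒≡1 (divides u eq) = u , cong suc eq

∣-≡1 : ∀ {d e x} → d ∣ e → x ≡1[mod e ] → x ≡1[mod d ]
∣-≡1 {x = suc _} d∣e x≡1 = ∣⇒≡1 (∣-trans d∣e (≡1⇒∣ x≡1))

^-≡1 : ∀ {x d} n → x ≡1[mod d ] → x ^ n ≡1[mod d ]
^-≡1 {suc c} {d} n x≡1 = subst (_≡1[mod d ]) (sym (^≡1+[b-1]*geometric c n))
  (∣⇒≡1 (∣m⇒∣m*n (geometric (suc c) n) (≡1⇒∣ x≡1)))

-- For `x = suc c` and `y = 1 + u * d`, the number `x * y - 1` is `x * u * d + c`, so `d` divides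
-- `c`.
*-≡1-cancelʳ : ∀ {x y d} → x * y ≡1[mod d ] → y ≡1[mod d ] → x ≡1[mod d ]
*-≡1-cancelʳ {suc c} {d = d} (v , xy≡) (u , refl) = ∣⇒≡1 (∣m+n∣m⇒∣n
  (divides v (suc-injective (trans (rearrange c u d) xy≡))) (n∣m*n (suc c * u)))
  where
  rearrange : ∀ c u d → suc (suc c * u * d + c) ≡ suc c * (1 + u * d)
  rearrange = solve-∀

-- By Bézout some multiple of one exponent exceeds a multiple of the other by 1. The larger power is
-- then `x` times the smaller, and both are 1 modulo `d`.
≡1-coprime-exponents : ∀ {x d m n} → Coprime m n → x ^ m ≡1[mod d ] → x ^ n ≡1[mod d ] → x ≡1[mod d ]
≡1-coprime-exponents {x} {d} {m} {n} m⊥n x^m≡1 x^n≡1 = case coprime-Bézout m⊥n of λ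
  { (Bézout.+- i j eq) → *-≡1-cancelʳ (subst (_≡1[mod d ]) (split i j m n eq) (^-≡1 i x^m≡1)) (^-≡1 j x^n≡1)
  ; (Bézout.-+ i j eq) → *-≡1-cancelʳ (subst (_≡1[mod d ]) (split j i n m eq) (^-≡1 j x^n≡1)) (^-≡1 i x^m≡1)
  }
  where
  open ≡-Reasoning
  split : ∀ i j m n → 1 + j * n ≡ i * m → (x ^ m) ^ i ≡ x * (x ^ n) ^ j
  split i j m n eq = begin
    (x ^ m) ^ i     ≡⟨ ^-*-assoc x m i ⟩
    x ^ (m * i)     ≡⟨ cong (x ^_) (trans (*-comm m i) (trans (sym eq) (cong suc (*-comm j n)))) ⟩
    x * x ^ (n * j) ≡⟨ cong (x *_) (^-*-assoc x n j) ⟨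
    x * (x ^ n) ^ j ∎

-- From `x ^ p = x + m * p`, `p` divides `x * (x ^ pred p - 1)`. The second factor is written as
-- `c * geometric x n`, and Euclid's lemma selects it.
fermat : ∀ {p x} → Prime p → ¬ p ∣ x → x ^ pred p ≡1[mod p ]
fermat {zero}          pp p∤x = ⊥-elim (¬prime[0] pp)
fermat {suc n} {zero}  pp p∤x = ⊥-elim (p∤x (suc n ∣.∣0))
fermat {p@(suc n)} {x@(suc c)} pp p∤x with x^p≡x+mp pp x
... | m , x^p≡ with euclidsLemma x (c * geometric x n) pp (divides m (+-cancelˡ-≡ x _ _ (begin
  x + x * (c * geometric x n) ≡⟨ *-suc x _ ⟨
  x * (1 + c * geometric x n) ≡⟨ cong (x *_) (^≡1+[b-1]*geometric c n) ⟨
  x ^ p                       ≡⟨ x^p≡ ⟩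
  x + m * p                   ∎)))
  where open ≡-Reasoning
... | inj₁ p∣x = ⊥-elim (p∤x p∣x)
... | inj₂ p∣cg = subst (_≡1[mod p ]) (sym (^≡1+[b-1]*geometric c n)) (∣⇒≡1 p∣cg)

-- Prime divisors congruent to 1 modulo `p`.

∃-prime-divisor : ∀ n → .{{NonZero n}} → ¬ n ≡ 1 → ∃ λ q → Prime q × q ∣ n
∃-prime-divisor n n≢1 with factorise n
... | record { factors = []     ; isFactorisation = n≡1 }   = ⊥-elim (n≢1 n≡1)
... | record { factors = q ∷ qs ; isFactorisation = n≡Π ; factorsPrime = pq ∷ _ } =
  q , pq , subst (q ∣_) (sym n≡Π) (m∣m*n (product qs))

prime∣prime⇒≡ : ∀ {q p} → Prime q → Prime p → q ∣ p → q ≡ p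
prime∣prime⇒≡ pq pp q∣p with prime⇒irreducible pp q∣p
... | inj₁ refl = ⊥-elim (¬prime[1] pq)
... | inj₂ q≡p  = q≡p

prime∤⇒coprime : ∀ {p m} → Prime p → ¬ p ∣ m → Coprime p m
prime∤⇒coprime pp p∤m (d∣p , d∣m) with prime⇒irreducible pp d∣p
... | inj₁ d≡1  = d≡1
... | inj₂ refl = ⊥-elim (p∤m d∣m)

prime-divisor-≡1 : ∀ {p n b} → Prime p → .{{NonZero n}} → ¬ p ∣ n →
  b ^ p ≡1[mod n ] → ¬ b ≡1[mod n ] → ∃ λ q → Prime q × q ∣ n × p ∣ pred q
prime-divisor-≡1 {zero}  {b = zero} pp = ⊥-elim (¬prime[0] pp)
prime-divisor-≡1 {suc _} {b = zero} pp _ (_ , ())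
prime-divisor-≡1 {p} {n} {b@(suc c)} pp p∤n b^p≡1 b≢1 with gcd n (geometric b p) ≟ 1
-- Here `n` divides `c * geometric b p` and is coprime to the sum, so it divides `c = b - 1`.
... | yes g≡1 = ⊥-elim (b≢1 (∣⇒≡1 (coprime-divisor (gcd≡1⇒coprime g≡1)
  (subst (n ∣_) (*-comm c _) (≡1⇒∣ (subst (_≡1[mod n ]) (^≡1+[b-1]*geometric c p) b^p≡1))))))
... | no g≢1 with ∃-prime-divisor (gcd n (geometric b p))
                    {{≢-nonZero (≢-nonZero⁻¹ n ∘ gcd[m,n]≡0⇒m≡0)}} g≢1
... | q , pq , q∣g with ∣-trans q∣g (gcd[m,n]∣m n (geometric b p)) | p ∣? pred q
... | q∣n | yes p∣q-1 = q , pq , q∣n , p∣q-1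
... | q∣n | no p∤q-1 = ⊥-elim (p∤n (subst (_∣ n) (prime∣prime⇒≡ pq pp q∣p) q∣n))
  where
  b^p≡1[q] : b ^ p ≡1[mod q ]
  b^p≡1[q] = ∣-≡1 q∣n b^p≡1
  -- Fermat at `q` requires this; otherwise `q` would divide `b ^ p = 1 + u * q`, hence 1.
  q∤b : ¬ q ∣ b
  q∤b q∣b with b^p≡1[q]
  ... | u , eq = prime∤1 pq (∣m+n∣m⇒∣n (subst (q ∣_) (trans eq (+-comm 1 (u * q)))
    (∣-^ p {{prime⇒nonZero pp}})) (n∣m*n u))
    where
    ∣-^ : ∀ p → .{{NonZero p}} → q ∣ b ^ p
    ∣-^ (suc p) = ∣m⇒∣m*n (b ^ p) q∣b
  -- The exponents `p` and `q - 1` are coprime and both take `b` to 1 modulo `q`.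
  q∣c : q ∣ c
  q∣c = ≡1⇒∣ (≡1-coprime-exponents (prime∤⇒coprime pp p∤q-1) b^p≡1[q] (fermat pq q∤b))
  q∣p : q ∣ p
  q∣p with geometric≡n+ch c p
  ... | h , eq = ∣m+n∣m⇒∣n (subst (q ∣_) (trans eq (+-comm p (c * h)))
    (∣-trans q∣g (gcd[m,n]∣n n (geometric b p)))) (∣m⇒∣m*n h q∣c)

-- The cofactor of q is also ≡ 1 (mod p), so if it is not 1 then n ≥ (p + 1)².
divisor≡1⇒≡ : ∀ {p n q} → n ≡1[mod p ] → n ≤ p * p + 1 → 1 < q → q ∣ n → p ∣ pred q → q ≡ n
divisor≡1⇒≡ {q = 1} _ _ (s≤s ())
divisor≡1⇒≡ {p} {n} {q@(suc q-1@(suc _))} n≡1 n≤p²+1 _ (divides r n≡rq) p∣q-1 =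
  go r n≡rq (*-≡1-cancelʳ (subst (_≡1[mod p ]) n≡rq n≡1) (∣⇒≡1 p∣q-1))
  where
  go : ∀ r → n ≡ r * q → r ≡1[mod p ] → q ≡ n
  -- The cofactor 0 does not arise, as `0 ≡1[mod p ]` is empty.
  go 1 n≡q _ = sym (trans n≡q (*-identityˡ q))
  go (suc r-1@(suc _)) n≡rq r≡1 = ⊥-elim (<⇒≱ n<rq (≤-reflexive (sym n≡rq)))
    where
    open ≤-Reasoning
    n<rq : n < suc r-1 * q
    n<rq = begin-strict
      n                           ≤⟨ n≤p²+1 ⟩
      p * p + 1                   ≡⟨ +-comm (p * p) 1 ⟩
      1 + p * p                   ≤⟨ +-monoʳ-≤ 1 (*-mono-≤ (∣⇒≤ (≡1⇒∣ r≡1)) (∣⇒≤ p∣q-1)) ⟩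
      1 + r-1 * q-1               <⟨ m<m+n (1 + r-1 * q-1) (s≤s z≤n) ⟩
      1 + r-1 * q-1 + (r-1 + q-1) ≡⟨ rearrange r-1 q-1 ⟩
      suc r-1 * q                 ∎
      where
      rearrange : ∀ r q → 1 + r * q + (r + q) ≡ suc r * suc q
      rearrange = solve-∀

-- The primality criterion.

[mod]⇔≡1 : ∀ {x d} → .{{NonZero x}} → (x ≡ 1 [mod d ]) ⇔ x ≡1[mod d ]
-- The integer `+ suc c - + 1` computes to `+ c`, so the left side unfolds to `d ∣ c`.
[mod]⇔≡1 {suc c} = mk⇔ ∣⇒≡1 ≡1⇒∣

corollary2p4 : ∀ (a p K N : ℕ) → a > 1 → Prime p → K ≥ 1 → N ≡ 2 * K * p + 1 →
    2 * K ≤ p → ((+ (2 * K)) / 1) <log[ a ] (2 * K * p + 1) →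
    Prime N ⇔ (a ^ (N ∸ 1) ≡ 1 [mod N ])
corollary2p4 a@(suc _) p K@(suc _) N a>1 pp _ refl 2K≤p a^2K<N^1 = mk⇔
  (λ pN → Equivalence.from [mod]⇔≡1 (fermat pN N∤a))
  (λ a^N-1≡1 → N-prime (Equivalence.to [mod]⇔≡1 a^N-1≡1))
  where
  b = a ^ (2 * K)
  instance
    _ = m^n≢0 a (N ∸ 1)
    _ = >-nonZero {N} (m≤n+m 1 (2 * K * p))
  b<N : b < N
  -- At a rational with denominator 1, the cut unfolds to `a ^ (2 * K) < N ^ 1`.
  b<N = subst (b <_) (^-identityʳ N) a^2K<N^1
  a≤b : a ≤ b
  a≤b = subst (_≤ b) (^-identityʳ a) (^-monoʳ-≤ a {1} {2 * K} (s≤s z≤n))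
  N∤a : ¬ N ∣ a
  N∤a N∣a = <⇒≱ (≤-<-trans a≤b b<N) (∣⇒≤ N∣a)
  N≡1[p] : N ≡1[mod p ]
  N≡1[p] = 2 * K , +-comm (2 * K * p) 1
  p∤N : ¬ p ∣ N
  p∤N p∣N = prime∤1 pp (∣m+n∣m⇒∣n p∣N (n∣m*n (2 * K)))
  b≢1 : ¬ b ≡1[mod N ]
  -- Quotient 0 contradicts `1 < a ≤ b`; a positive quotient contradicts `b < N`.
  b≢1 (zero  , b≡1)   = <⇒≢ (<-≤-trans a>1 a≤b) (sym b≡1)
  b≢1 (suc u , b≡1+N) = <⇒≱ b<N (subst (N ≤_) (sym b≡1+N) (≤-trans (m≤m+n N (u * N)) (n≤1+n _)))
  N-prime : a ^ (N ∸ 1) ≡1[mod N ] → Prime N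
  N-prime a^N-1≡1 with prime-divisor-≡1 pp p∤N (subst (_≡1[mod N ]) a^N-1≡b^p a^N-1≡1) b≢1
    where
    a^N-1≡b^p : a ^ (N ∸ 1) ≡ b ^ p
    a^N-1≡b^p = trans (cong (a ^_) (m+n∸n≡m (2 * K * p) 1)) (sym (^-*-assoc a (2 * K) p))
  ... | q , pq , q∣N , p∣q-1 = subst Prime
    -- The bound `2 * K ≤ p` gives `N ≤ p * p + 1`, which forces the prime `q` to be `N` itself.
    (divisor≡1⇒≡ N≡1[p] (+-monoˡ-≤ 1 (*-monoˡ-≤ p 2K≤p)) (nonTrivial⇒n>1 q {{prime⇒nonTrivial pq}}) q∣N p∣q-1) pq
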